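{- Let $D\ge2$, $N\in\{2D,2D+1\}$, and let $\Gamma$ be the cycle graph on $X=\{0,\dots,N-1\}$ with standard module $V$. For $h,i,j\in\{0,\dots,D\}$ let $P_{h,i,j}=\sum x\otimes y\otimes z\in V^{\otimes3}$, the sum over $x,y,z\in X$ with $\partial(y,z)=h$, $\partial(x,z)=i$ and $\partial(x,y)=j$. Then the number of triples $(h,i,j)\in\{0,\dots,D\}^3$ with $P_{h,i,j}\ne\mathbf0$ is $2D^2+2$ if $N=2D$, and $2D^2+2D+1$ if $N=2D+1$.
   Context: $\Gamma$ has vertex set $X=\mathbb{Z}/N\mathbb{Z}$, with $x\sim y$ iff $x-y\equiv\pm1 \pmod N$. Its distance is $\partial(x,y)=\min\{r,N-r\}$ with $r\equiv x-y \pmod N$, $0\le r<N$, and its diameter is $D$. $V$ is the complex vector space with basis $X$. -}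

module Defs where

open import Data.Nat using (ℕ; zero; suc; _+_; _*_; _∸_; _⊓_; _≟_; _≡ᵇ_)
open import Data.Nat.DivMod using (_%_)
open import Data.Bool using (Bool; true; false; if_then_else_; _∧_)
open import Data.Fin using (Fin; toℕ)
open import Data.Fin.Properties using (all?)
open import Data.List using (List; upTo; concatMap; map; filter; length)
open import Data.Product using (_×_; _,_)
open import Relation.Binary.PropositionalEquality using (_≡_)
open import Relation.Nullary using (Dec; ¬_; ¬?)

-- Cycle graph on X = Z/NZ, vertices represented by Fin N.
-- ∂(x,y) = min{r, N - r} with r ≡ x - y (mod N), 0 ≤ r < N.
dist : ∀ {N} → Fin N → Fin N → ℕ
dist {suc n} x y =
  let r = (toℕ x + (suc n ∸ toℕ y)) % suc n in r ⊓ (suc n ∸ r)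

-- Elements of V^{⊗3} are represented by their coefficient functions with
-- respect to the standard basis {x ⊗ y ⊗ z : x,y,z ∈ X}.  All coefficients
-- occurring here are 0 or 1, so natural-number coefficients suffice.
Tensor3 : ℕ → Set
Tensor3 N = Fin N → Fin N → Fin N → ℕ

P : (N h i j : ℕ) → Tensor3 N
P N h i j x y z =
  if (dist y z ≡ᵇ h) ∧ (dist x z ≡ᵇ i) ∧ (dist x y ≡ᵇ j) then 1 else 0

IsZero : ∀ {N} → Tensor3 N → Set
IsZero v = ∀ x y z → v x y z ≡ 0

isZero? : ∀ {N} (v : Tensor3 N) → Dec (IsZero v)
isZero? v = all? λ x → all? λ y → all? λ z → v x y z ≟ 0

triples : ℕ → List (ℕ × ℕ × ℕ)
triples D = concatMap (λ h → concatMap (λ i → map (λ j → h , i , j) (upTo (suc D)))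
                                        (upTo (suc D)))
                      (upTo (suc D))

countNonzero : (N D : ℕ) → ℕ
countNonzero N D =
  length (filter (λ { (h , i , j) → ¬? (isZero? (P N h i j)) }) (triples D))

-- Three points on the N-cycle cut it into arcs p, q, s with p + q + s = N, and each distance
-- between them is an arc or its complement.  Hence a triple (h, i, j) with h, i, j ≤ N/2 is
-- realised iff one of h, i, j is the sum of the other two or h + i + j = N; for given h and i this
-- leaves exactly j = ∣h - i∣ and j = min(h + i, N - h - i).  These coincide iff h or i is 0 or N/2,
-- so the count is Σ_{h,i ≤ D} (1 + [h interior] [i interior]) = (D + 1)² + I², where I, the number
-- of h ≤ D that are neither 0 nor N/2, is D - 1 for N = 2D and D for N = 2D + 1.
module Submission where

open import Defs
open import Data.Nat using (ℕ; _+_; _*_; _≤_)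
open import Data.Product using (_×_)
open import Relation.Binary.PropositionalEquality using (_≡_)

open import Data.Bool using (true; false; T; if_then_else_)
open import Data.Bool.Properties using (T-∧)
open import Data.Empty using (⊥)
open import Data.Fin using (Fin; toℕ; fromℕ<)
open import Data.Fin.Properties using (toℕ<n; toℕ-fromℕ<)
open import Data.List using (List; []; _∷_; [_]; _++_; map; filter; length; concatMap; upTo)
open import Data.List.Properties
  using (length-++; filter-++; filter-≐; filter-accept; filter-reject; filter-none;
         map-cong; map-cong-local; map-++; upTo-∷ʳ; map-upTo; map-applyUpTo; length-upTo)
open import Data.List.Relation.Unary.All using (All; []; _∷_)
open import Data.List.Relation.Unary.All.Properties using (applyUpTo⁺₁)
open import Data.Nat using (zero; suc; _∸_; _⊓_; _<_; ∣_-_∣; NonZero; s≤s; z<s)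
open import Data.Nat.DivMod using (_%_; [m+n]%n≡m%n; m<n⇒m%n≡m)
open import Data.Nat.ListAction using (sum)
open import Data.Nat.ListAction.Properties using (sum-++)
open import Data.Nat.Properties
open import Algebra.Properties.CommutativeSemigroup +-commutativeSemigroup
  using (x∙yz≈y∙xz; xy∙z≈xz∙y; xy∙z≈yz∙x; xy∙z≈y∙xz)
open import Data.Nat.Tactic.RingSolver using (solve-∀)
open import Data.Product using (_,_)
open import Data.Sum using (_⊎_; inj₁; inj₂; reduce)
open import Data.Unit using (tt)
open import Function using (_∘_; id; _⇔_; mk⇔; Equivalence)
open import Level using (Level)
open import Relation.Binary.PropositionalEquality
  using (_≢_; refl; sym; trans; cong; cong₂; subst; module ≡-Reasoning)
open import Relation.Nullary using (Dec; yes; no; ¬_; ¬?; does; contradiction)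
open import Relation.Nullary.Decidable using (_⊎-dec_; decidable-stable; dec-true; dec-false)
open import Relation.Unary using (Pred; Decidable)

open Equivalence using (to; from)

private
  variable
    ℓ ℓ′ ℓ₁ ℓ₂ : Level
    A : Set ℓ₁
    B : Set ℓ₂

length-filter-concatMap : ∀ {Q : Pred B ℓ} (Q? : Decidable Q) (f : A → List B) xs →
  length (filter Q? (concatMap f xs)) ≡ sum (map (λ x → length (filter Q? (f x))) xs)
length-filter-concatMap Q? f []       = refl
length-filter-concatMap Q? f (x ∷ xs) = begin
  length (filter Q? (f x ++ concatMap f xs))
    ≡⟨ cong length (filter-++ Q? (f x) _) ⟩
  length (filter Q? (f x) ++ filter Q? (concatMap f xs))
    ≡⟨ length-++ (filter Q? (f x)) ⟩
  length (filter Q? (f x)) + length (filter Q? (concatMap f xs))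
    ≡⟨ cong (_ +_) (length-filter-concatMap Q? f xs) ⟩
  length (filter Q? (f x)) + sum (map (λ x → length (filter Q? (f x))) xs)
    ∎
  where open ≡-Reasoning

length-filter-map : ∀ {Q : Pred B ℓ} (Q? : Decidable Q) (f : A → B) xs →
  length (filter Q? (map f xs)) ≡ length (filter (Q? ∘ f) xs)
length-filter-map Q? f []       = refl
length-filter-map Q? f (x ∷ xs) with Q? (f x)
... | yes _ = cong suc (length-filter-map Q? f xs)
... | no  _ = length-filter-map Q? f xs

filter-≐-local : ∀ {Q : Pred A ℓ} {R : Pred A ℓ′} (Q? : Decidable Q) (R? : Decidable R) {xs} →
  All (λ x → Q x ⇔ R x) xs → filter Q? xs ≡ filter R? xs
filter-≐-local Q? R? []                      = refl
filter-≐-local Q? R? {x ∷ _} (Qx⇔Rx ∷ Q⇔R) with Q? x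
... | yes Qx = trans (cong (x ∷_) (filter-≐-local Q? R? Q⇔R)) (sym (filter-accept R? (Qx⇔Rx .to Qx)))
... | no ¬Qx = trans (filter-≐-local Q? R? Q⇔R) (sym (filter-reject R? (¬Qx ∘ Qx⇔Rx .from)))

length-filter-⊎ : ∀ {Q : Pred A ℓ} {R : Pred A ℓ′} (Q? : Decidable Q) (R? : Decidable R) →
  (∀ {x} → Q x → R x → ⊥) → ∀ xs →
  length (filter (λ x → Q? x ⊎-dec R? x) xs) ≡ length (filter Q? xs) + length (filter R? xs)
length-filter-⊎ Q? R? disjoint []       = refl
length-filter-⊎ Q? R? disjoint (x ∷ xs) with Q? x | R? x
... | yes Qx | yes Rx = contradiction Rx (disjoint Qx)
... | yes _  | no  _  = cong suc (length-filter-⊎ Q? R? disjoint xs)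
... | no  _  | yes _  = trans (cong suc (length-filter-⊎ Q? R? disjoint xs)) (sym (+-suc _ _))
... | no  _  | no  _  = length-filter-⊎ Q? R? disjoint xs

filter-≟-upTo : ∀ {k} n → k < n → filter (_≟ k) (upTo n) ≡ [ k ]
filter-≟-upTo {k} (suc n) k<1+n = begin
  filter (_≟ k) (upTo (suc n))                  ≡⟨ cong (filter (_≟ k)) (upTo-∷ʳ n) ⟨
  filter (_≟ k) (upTo n ++ [ n ])               ≡⟨ filter-++ (_≟ k) (upTo n) [ n ] ⟩
  filter (_≟ k) (upTo n) ++ filter (_≟ k) [ n ] ≡⟨ split (m<1+n⇒m<n∨m≡n k<1+n) ⟩
  [ k ]                                         ∎
  where
  open ≡-Reasoning
  split : k < n ⊎ k ≡ n → filter (_≟ k) (upTo n) ++ filter (_≟ k) [ n ] ≡ [ k ]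
  split (inj₁ k<n) rewrite filter-reject (_≟ k) {xs = []} (>⇒≢ k<n) | filter-≟-upTo n k<n = refl
  split (inj₂ refl)
    rewrite filter-none (_≟ k) (applyUpTo⁺₁ id k <⇒≢) | filter-accept (_≟ k) {xs = []} refl = refl

length-filter-≟-pair-≡ : ∀ {k l} n → k < n → k ≡ l →
  length (filter (λ j → j ≟ k ⊎-dec j ≟ l) (upTo n)) ≡ 1
length-filter-≟-pair-≡ {k} n k<n refl = begin
  length (filter (λ j → j ≟ k ⊎-dec j ≟ k) (upTo n))
    ≡⟨ cong length (filter-≐ _ (_≟ k) (reduce , inj₁) (upTo n)) ⟩
  length (filter (_≟ k) (upTo n))
    ≡⟨ cong length (filter-≟-upTo n k<n) ⟩
  1 ∎
  where open ≡-Reasoning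

length-filter-≟-pair-≢ : ∀ {k l} n → k < n → l < n → k ≢ l →
  length (filter (λ j → j ≟ k ⊎-dec j ≟ l) (upTo n)) ≡ 2
length-filter-≟-pair-≢ {k} {l} n k<n l<n k≢l = begin
  length (filter (λ j → j ≟ k ⊎-dec j ≟ l) (upTo n))
    ≡⟨ length-filter-⊎ (_≟ k) (_≟ l) (λ j≡k j≡l → k≢l (trans (sym j≡k) j≡l)) (upTo n) ⟩
  length (filter (_≟ k) (upTo n)) + length (filter (_≟ l) (upTo n))
    ≡⟨ cong₂ (λ xs ys → length xs + length ys) (filter-≟-upTo n k<n) (filter-≟-upTo n l<n) ⟩
  2 ∎
  where open ≡-Reasoning

sum-map-+ : ∀ (f g : A → ℕ) xs → sum (map (λ x → f x + g x) xs) ≡ sum (map f xs) + sum (map g xs)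
sum-map-+ f g []       = refl
sum-map-+ f g (x ∷ xs) = begin
  f x + g x + sum (map (λ x → f x + g x) xs)        ≡⟨ cong (f x + g x +_) (sum-map-+ f g xs) ⟩
  f x + g x + (sum (map f xs) + sum (map g xs))     ≡⟨ +-assoc (f x) (g x) _ ⟩
  f x + (g x + (sum (map f xs) + sum (map g xs)))   ≡⟨ cong (f x +_) (x∙yz≈y∙xz (g x) (sum (map f xs)) _) ⟩
  f x + (sum (map f xs) + (g x + sum (map g xs)))   ≡⟨ +-assoc (f x) _ _ ⟨
  f x + sum (map f xs) + (g x + sum (map g xs))     ∎
  where open ≡-Reasoning

sum-map-*ˡ : ∀ c (f : A → ℕ) xs → sum (map (λ x → c * f x) xs) ≡ c * sum (map f xs)
sum-map-*ˡ c f []       = sym (*-zeroʳ c)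
sum-map-*ˡ c f (x ∷ xs) =
  trans (cong (c * f x +_) (sum-map-*ˡ c f xs)) (sym (*-distribˡ-+ c (f x) _))

sum-map-const : ∀ c (xs : List A) → sum (map (λ _ → c) xs) ≡ length xs * c
sum-map-const c []       = refl
sum-map-const c (x ∷ xs) = cong (c +_) (sum-map-const c xs)

sum-map-1+product : ∀ (g : A → ℕ) xs →
  sum (map (λ x → sum (map (λ y → 1 + g x * g y) xs)) xs)
    ≡ length xs * length xs + sum (map g xs) * sum (map g xs)
sum-map-1+product g xs = begin
  sum (map (λ x → sum (map (λ y → 1 + g x * g y) xs)) xs)
    ≡⟨ cong sum (map-cong row xs) ⟩
  sum (map (λ x → length xs + S * g x) xs)
    ≡⟨ sum-map-+ (λ _ → length xs) _ xs ⟩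
  sum (map (λ _ → length xs) xs) + sum (map (λ x → S * g x) xs)
    ≡⟨ cong₂ _+_ (sum-map-const (length xs) xs) (sum-map-*ˡ S g xs) ⟩
  length xs * length xs + S * S
    ∎
  where
  open ≡-Reasoning
  S = sum (map g xs)
  row : ∀ x → sum (map (λ y → 1 + g x * g y) xs) ≡ length xs + S * g x
  row x = begin
    sum (map (λ y → 1 + g x * g y) xs)
      ≡⟨ sum-map-+ (λ _ → 1) (λ y → g x * g y) xs ⟩
    sum (map (λ _ → 1) xs) + sum (map (λ y → g x * g y) xs)
      ≡⟨ cong₂ _+_ (sum-map-const 1 xs) (sum-map-*ˡ (g x) g xs) ⟩
    length xs * 1 + g x * S
      ≡⟨ cong₂ _+_ (*-identityʳ (length xs)) (*-comm (g x) S) ⟩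
    length xs + S * g x
      ∎

map-cong-upTo : ∀ {f g : ℕ → A} n → (∀ {k} → k < n → f k ≡ g k) → map f (upTo n) ≡ map g (upTo n)
map-cong-upTo n f≡g = map-cong-local (applyUpTo⁺₁ id n f≡g)

sum-map-upTo-suc : ∀ (f : ℕ → ℕ) n → sum (map f (upTo (suc n))) ≡ f 0 + sum (map (f ∘ suc) (upTo n))
sum-map-upTo-suc f n =
  cong (λ ys → f 0 + sum ys) (trans (map-applyUpTo suc f n) (sym (map-upTo (f ∘ suc) n)))

sum-map-upTo-∷ʳ : ∀ (f : ℕ → ℕ) n → sum (map f (upTo (suc n))) ≡ sum (map f (upTo n)) + f n
sum-map-upTo-∷ʳ f n = begin
  sum (map f (upTo (suc n)))             ≡⟨ cong (sum ∘ map f) (upTo-∷ʳ n) ⟨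
  sum (map f (upTo n ++ [ n ]))          ≡⟨ cong sum (map-++ f (upTo n) [ n ]) ⟩
  sum (map f (upTo n) ++ [ f n ])        ≡⟨ sum-++ (map f (upTo n)) [ f n ] ⟩
  sum (map f (upTo n)) + (f n + 0)       ≡⟨ cong (sum (map f (upTo n)) +_) (+-identityʳ (f n)) ⟩
  sum (map f (upTo n)) + f n             ∎
  where open ≡-Reasoning

sum-map-upTo-const : ∀ {c} (f : ℕ → ℕ) n → (∀ {k} → k < n → f k ≡ c) →
  sum (map f (upTo n)) ≡ n * c
sum-map-upTo-const {c} f n f≡c = begin
  sum (map f (upTo n))          ≡⟨ cong sum (map-cong-upTo n f≡c) ⟩
  sum (map (λ _ → c) (upTo n))  ≡⟨ sum-map-const c (upTo n) ⟩
  length (upTo n) * c           ≡⟨ cong (_* c) (length-upTo n) ⟩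
  n * c                         ∎
  where open ≡-Reasoning

m+m≤1+n+n⇒m≤n : ∀ m n → m + m ≤ suc (n + n) → m ≤ n
m+m≤1+n+n⇒m≤n m n 2m≤1+2n =
  ≮⇒≥ λ n<m → <⇒≱ (<-≤-trans (s≤s (≤-reflexive (sym (+-suc n n)))) (+-mono-≤ n<m n<m)) 2m≤1+2n

m+m≤1+n⇒m<1+n : ∀ {n} m → m + m ≤ suc n → m < suc n
m+m≤1+n⇒m<1+n zero    _      = z<s
m+m≤1+n⇒m<1+n (suc m) 2m≤1+n = <-≤-trans (m<m+n (suc m) z<s) 2m≤1+n

m+m≤o⇒n+n≤o⇒m+n≤o : ∀ {o} m n → m + m ≤ o → n + n ≤ o → m + n ≤ o
m+m≤o⇒n+n≤o⇒m+n≤o m n 2m≤o 2n≤o with ≤-total m n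
... | inj₁ m≤n = ≤-trans (+-monoˡ-≤ n m≤n) 2n≤o
... | inj₂ n≤m = ≤-trans (+-monoʳ-≤ m n≤m) 2m≤o

m+m≤o⇒n+n≤o⇒∣m-n∣+∣m-n∣≤o : ∀ {o} m n → m + m ≤ o → n + n ≤ o → ∣ m - n ∣ + ∣ m - n ∣ ≤ o
m+m≤o⇒n+n≤o⇒∣m-n∣+∣m-n∣≤o m n 2m≤o 2n≤o with ∣m-n∣≡[m∸n]∨[n∸m] m n
... | inj₁ e rewrite e = ≤-trans (+-mono-≤ (m∸n≤m m n) (m∸n≤m m n)) 2m≤o
... | inj₂ e rewrite e = ≤-trans (+-mono-≤ (m∸n≤m n m) (m∸n≤m n m)) 2n≤o

∣1+m-1+n∣<1+m+1+n : ∀ m n → ∣ suc m - suc n ∣ < suc m + suc n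
∣1+m-1+n∣<1+m+1+n m n =
  s≤s (≤-trans (≤-trans (∣m-n∣≤m⊔n m n) (m⊔n≤m+n m n)) (+-monoʳ-≤ m (n≤1+n n)))

minArc : ℕ → ℕ → ℕ
minArc N t = t ⊓ (N ∸ t)

minArc-short : ∀ {N t} → t + t ≤ N → minArc N t ≡ t
minArc-short {N} {t} 2t≤N = m≤n⇒m⊓n≡m (m+n≤o⇒m≤o∸n t 2t≤N)

minArc-long : ∀ {N t} → N ≤ t + t → minArc N t ≡ N ∸ t
minArc-long {N} {t} N≤2t = m≥n⇒m⊓n≡n (m≤n+o⇒m∸n≤o N t N≤2t)

minArc-complement : ∀ {N t} → t ≤ N → minArc N (N ∸ t) ≡ minArc N t
minArc-complement {N} {t} t≤N = begin
  (N ∸ t) ⊓ (N ∸ (N ∸ t)) ≡⟨ cong ((N ∸ t) ⊓_) (m∸[m∸n]≡n t≤N) ⟩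
  (N ∸ t) ⊓ t             ≡⟨ ⊓-comm (N ∸ t) t ⟩
  t ⊓ (N ∸ t)             ∎
  where open ≡-Reasoning

minArc-+ : ∀ t r → minArc (t + r) t ≡ t ⊓ r
minArc-+ t r = cong (t ⊓_) (m+n∸m≡n t r)

minArc-half : ∀ {N t} → t ≤ N → minArc N t + minArc N t ≤ N
minArc-half {N} {t} t≤N =
  ≤-trans (+-mono-≤ (m⊓n≤m t (N ∸ t)) (m⊓n≤n t (N ∸ t))) (≤-reflexive (m+[n∸m]≡n t≤N))

cycDist : ℕ → ℕ → ℕ → ℕ
cycDist N a b = minArc N ∣ a - b ∣

cycDist-comm : ∀ N a b → cycDist N a b ≡ cycDist N b a
cycDist-comm N a b = cong (minArc N) (∣-∣-comm a b)

cycDist-zeroʳ : ∀ N a → cycDist N a 0 ≡ minArc N a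
cycDist-zeroʳ N a = cong (minArc N) (∣-∣-identityʳ a)

[a+[N∸b]]%N≡a∸b : ∀ {N a b} .{{_ : NonZero N}} → b ≤ a → a < N → (a + (N ∸ b)) % N ≡ a ∸ b
[a+[N∸b]]%N≡a∸b {N} {a} {b} b≤a a<N = begin
  (a + (N ∸ b)) % N ≡⟨ cong (_% N) (sym (+-∸-assoc a b≤N)) ⟩
  (a + N ∸ b) % N   ≡⟨ cong (_% N) (+-∸-comm N b≤a) ⟩
  (a ∸ b + N) % N   ≡⟨ [m+n]%n≡m%n (a ∸ b) N ⟩
  (a ∸ b) % N       ≡⟨ m<n⇒m%n≡m (≤-<-trans (m∸n≤m a b) a<N) ⟩
  a ∸ b             ∎
  where
  open ≡-Reasoning
  b≤N = ≤-trans b≤a (<⇒≤ a<N)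

[a+[N∸b]]%N≡N∸[b∸a] : ∀ {N a b} .{{_ : NonZero N}} → a < b → b ≤ N →
  (a + (N ∸ b)) % N ≡ N ∸ (b ∸ a)
[a+[N∸b]]%N≡N∸[b∸a] {N} {a} {b} a<b b≤N = begin
  r % N            ≡⟨ m<n⇒m%n≡m r<N ⟩
  r                ≡⟨ m+n∸n≡m r (b ∸ a) ⟨
  r + (b ∸ a) ∸ (b ∸ a) ≡⟨ cong (_∸ (b ∸ a)) r+[b∸a]≡N ⟩
  N ∸ (b ∸ a)      ∎
  where
  open ≡-Reasoning
  r = a + (N ∸ b)
  r+[b∸a]≡N : r + (b ∸ a) ≡ N
  r+[b∸a]≡N = begin
    a + (N ∸ b) + (b ∸ a)   ≡⟨ cong (_+ (b ∸ a)) (+-comm a (N ∸ b)) ⟩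
    N ∸ b + a + (b ∸ a)     ≡⟨ +-assoc (N ∸ b) a (b ∸ a) ⟩
    N ∸ b + (a + (b ∸ a))   ≡⟨ cong (N ∸ b +_) (m+[n∸m]≡n (<⇒≤ a<b)) ⟩
    N ∸ b + b               ≡⟨ m∸n+n≡m b≤N ⟩
    N                       ∎
  r<N : r < N
  r<N = subst (r <_) r+[b∸a]≡N (m<m+n r (m<n⇒0<n∸m a<b))

dist≡cycDist : ∀ {n} (x y : Fin (suc n)) → dist x y ≡ cycDist (suc n) (toℕ x) (toℕ y)
dist≡cycDist {n} x y with toℕ y ≤? toℕ x
... | yes b≤a = cong (minArc (suc n))
      (trans ([a+[N∸b]]%N≡a∸b b≤a (toℕ<n x)) (sym (m≤n⇒∣n-m∣≡n∸m b≤a)))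
... | no b≰a = begin
  minArc N ((a + (N ∸ b)) % N) ≡⟨ cong (minArc N) ([a+[N∸b]]%N≡N∸[b∸a] a<b b≤N) ⟩
  minArc N (N ∸ (b ∸ a))       ≡⟨ minArc-complement (≤-trans (m∸n≤m b a) b≤N) ⟩
  minArc N (b ∸ a)             ≡⟨ cong (minArc N) (m≤n⇒∣m-n∣≡n∸m (<⇒≤ a<b)) ⟨
  cycDist N a b                ∎
  where
  open ≡-Reasoning
  N = suc n
  a = toℕ x
  b = toℕ y
  a<b = ≰⇒> b≰a
  b≤N = <⇒≤ (toℕ<n y)

data Triangle (N h i j : ℕ) : Set where
  h≡i+j   : h ≡ i + j → Triangle N h i j
  i≡h+j   : i ≡ h + j → Triangle N h i j
  j≡h+i   : j ≡ h + i → Triangle N h i j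
  h+i+j≡N : h + i + j ≡ N → Triangle N h i j

triangle? : ∀ N h i j → Dec (Triangle N h i j)
triangle? N h i j with h ≟ i + j | i ≟ h + j | j ≟ h + i | h + i + j ≟ N
... | yes e | _     | _     | _     = yes (h≡i+j e)
... | no _  | yes e | _     | _     = yes (i≡h+j e)
... | no _  | no _  | yes e | _     = yes (j≡h+i e)
... | no _  | no _  | no _  | yes e = yes (h+i+j≡N e)
... | no a  | no b  | no c  | no d  = no λ where
  (h≡i+j e)   → a e
  (i≡h+j e)   → b e
  (j≡h+i e)   → c e
  (h+i+j≡N e) → d e

triangle-cong : ∀ {N h i j h′ i′ j′} → h ≡ h′ → i ≡ i′ → j ≡ j′ →
  Triangle N h i j → Triangle N h′ i′ j′
triangle-cong refl refl refl t = t

triangle-swap₁₂ : ∀ {N h i j} → Triangle N h i j → Triangle N i h j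
triangle-swap₁₂         (h≡i+j e)   = i≡h+j e
triangle-swap₁₂         (i≡h+j e)   = h≡i+j e
triangle-swap₁₂ {h = h} (j≡h+i e)   = j≡h+i (trans e (+-comm h _))
triangle-swap₁₂ {h = h} {i} {j} (h+i+j≡N e) = h+i+j≡N (trans (cong (_+ j) (+-comm i h)) e)

triangle-swap₂₃ : ∀ {N h i j} → Triangle N h i j → Triangle N h j i
triangle-swap₂₃ {i = i} (h≡i+j e)   = h≡i+j (trans e (+-comm i _))
triangle-swap₂₃         (i≡h+j e)   = j≡h+i e
triangle-swap₂₃         (j≡h+i e)   = i≡h+j e
triangle-swap₂₃ {h = h} {i} {j} (h+i+j≡N e) = h+i+j≡N (trans (xy∙z≈xz∙y h j i) e)

-- If one arc is at least the sum of the other two, the distance spanning it is the sum of the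
-- other two distances; otherwise every distance is its own arc and the three add up to N.
arcs-triangle : ∀ p q s → let N = p + q + s in
  Triangle N (minArc N q) (minArc N (p + q)) (minArc N p)
arcs-triangle p q s
  rewrite trans (cong (λ N → minArc N q) (xy∙z≈y∙xz p q s)) (minArc-+ q (p + s))
        | minArc-+ (p + q) s
        | trans (cong (λ N → minArc N p) (+-assoc p q s)) (minArc-+ p (q + s))
  with q + s ≤? p | p + s ≤? q | p + q ≤? s
... | yes q+s≤p | _ | _
  rewrite m≤n⇒m⊓n≡m (≤-trans (m≤m+n q s) (≤-trans q+s≤p (m≤m+n p s)))
        | m≥n⇒m⊓n≡n (≤-trans (m≤n+m s q) (≤-trans q+s≤p (m≤m+n p q)))
        | m≥n⇒m⊓n≡n q+s≤p
        = j≡h+i refl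
... | no _ | yes p+s≤q | _
  rewrite m≥n⇒m⊓n≡n p+s≤q
        | m≥n⇒m⊓n≡n (≤-trans (m≤n+m s p) (≤-trans p+s≤q (m≤n+m q p)))
        | m≤n⇒m⊓n≡m (≤-trans (m≤m+n p s) (≤-trans p+s≤q (m≤m+n q s)))
        = h≡i+j (+-comm p s)
... | no _ | no _ | yes p+q≤s
  rewrite m≤n⇒m⊓n≡m (≤-trans (m≤n+m q p) (≤-trans p+q≤s (m≤n+m s p)))
        | m≤n⇒m⊓n≡m p+q≤s
        | m≤n⇒m⊓n≡m (≤-trans (m≤m+n p q) (≤-trans p+q≤s (m≤n+m s q)))
        = i≡h+j (+-comm p q)
... | no q+s≰p | no p+s≰q | no p+q≰s
  rewrite m≤n⇒m⊓n≡m (<⇒≤ (≰⇒> p+s≰q))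
        | m≥n⇒m⊓n≡n (<⇒≤ (≰⇒> p+q≰s))
        | m≤n⇒m⊓n≡m (<⇒≤ (≰⇒> q+s≰p))
        = h+i+j≡N (sym (xy∙z≈yz∙x p q s))

PointsTriangle : ℕ → ℕ → ℕ → ℕ → Set
PointsTriangle N a b c = Triangle N (cycDist N b c) (cycDist N a c) (cycDist N a b)

points-swap₁₂ : ∀ {N} a b c → PointsTriangle N a b c → PointsTriangle N b a c
points-swap₁₂ {N} a b c = triangle-cong refl refl (cycDist-comm N a b) ∘ triangle-swap₁₂

points-swap₂₃ : ∀ {N} a b c → PointsTriangle N a b c → PointsTriangle N a c b
points-swap₂₃ {N} a b c = triangle-cong (cycDist-comm N b c) refl refl ∘ triangle-swap₂₃

sorted-points-triangle : ∀ {N u v w} → u ≤ v → v ≤ w → w < N → PointsTriangle N u v w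
sorted-points-triangle {u = u} u≤v v≤w w<N with m≤n⇒∃[o]m+o≡n u≤v | m≤n⇒∃[o]m+o≡n v≤w
... | p , refl | q , refl
  with m≤n⇒∃[o]m+o≡n (≤-trans (m≤n+m (p + q) u) (≤-trans (≤-reflexive (sym (+-assoc u p q))) (<⇒≤ w<N)))
... | s , refl = triangle-cong
  (cong (minArc _) (sym (∣m-m+n∣≡n (u + p) q)))
  (cong (minArc _) (sym (trans (cong (∣ u -_∣) (+-assoc u p q)) (∣m-m+n∣≡n u (p + q)))))
  (cong (minArc _) (sym (∣m-m+n∣≡n u p)))
  (arcs-triangle p q s)

points-triangle : ∀ {N a b c} → a < N → b < N → c < N → PointsTriangle N a b c
points-triangle {a = a} {b} {c} a<N b<N c<N with ≤-total a b | ≤-total b c | ≤-total a c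
... | inj₁ a≤b | inj₁ b≤c | _        = sorted-points-triangle a≤b b≤c c<N
... | inj₁ a≤b | inj₂ c≤b | inj₁ a≤c =
  points-swap₂₃ a c b (sorted-points-triangle a≤c c≤b b<N)
... | inj₁ a≤b | inj₂ c≤b | inj₂ c≤a =
  points-swap₂₃ a c b (points-swap₁₂ c a b (sorted-points-triangle c≤a a≤b b<N))
... | inj₂ b≤a | _        | inj₁ a≤c =
  points-swap₁₂ b a c (sorted-points-triangle b≤a a≤c c<N)
... | inj₂ b≤a | inj₁ b≤c | inj₂ c≤a =
  points-swap₁₂ b a c (points-swap₂₃ b c a (sorted-points-triangle b≤c c≤a a<N))
... | inj₂ b≤a | inj₂ c≤b | inj₂ c≤a =
  points-swap₁₂ b a c (points-swap₂₃ b c a (points-swap₁₂ c b a (sorted-points-triangle c≤b b≤a a<N)))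

indicator≢0⇒T : ∀ b → (if b then 1 else 0) ≢ 0 → T b
indicator≢0⇒T true  _   = tt
indicator≢0⇒T false ≢0 = ≢0 refl

T⇒indicator≡1 : ∀ {b} → T b → (if b then 1 else 0) ≡ 1
T⇒indicator≡1 {true} _ = refl

P-coefficient≢0⇒distances : ∀ {n h i j} (x y z : Fin (suc n)) → P (suc n) h i j x y z ≢ 0 →
  dist y z ≡ h × dist x z ≡ i × dist x y ≡ j
P-coefficient≢0⇒distances x y z ≢0 with T-∧ .to (indicator≢0⇒T _ ≢0)
... | t₁ , t₂₃ with T-∧ .to t₂₃
... | t₂ , t₃ = ≡ᵇ⇒≡ _ _ t₁ , ≡ᵇ⇒≡ _ _ t₂ , ≡ᵇ⇒≡ _ _ t₃

distances⇒P-coefficient≡1 : ∀ {n h i j} (x y z : Fin (suc n)) →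
  dist y z ≡ h → dist x z ≡ i → dist x y ≡ j → P (suc n) h i j x y z ≡ 1
distances⇒P-coefficient≡1 x y z e₁ e₂ e₃ =
  T⇒indicator≡1 (T-∧ .from (≡⇒≡ᵇ _ _ e₁ , T-∧ .from (≡⇒≡ᵇ _ _ e₂ , ≡⇒≡ᵇ _ _ e₃)))

-- ¬ IsZero does not exhibit a nonzero coefficient; decidability of Triangle and of each
-- coefficient makes up for it.
nonzero⇒triangle : ∀ {n h i j} → ¬ IsZero (P (suc n) h i j) → Triangle (suc n) h i j
nonzero⇒triangle {n} {h} {i} {j} P≢0 = decidable-stable (triangle? (suc n) h i j) λ ¬triangle →
  P≢0 λ x y z → decidable-stable (P (suc n) h i j x y z ≟ 0) λ ≢0 →
    ¬triangle (coefficient-triangle x y z (P-coefficient≢0⇒distances x y z ≢0))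
  where
  coefficient-triangle : ∀ x y z → dist y z ≡ h × dist x z ≡ i × dist x y ≡ j → Triangle (suc n) h i j
  coefficient-triangle x y z (e₁ , e₂ , e₃) = triangle-cong
    (trans (sym (dist≡cycDist y z)) e₁)
    (trans (sym (dist≡cycDist x z)) e₂)
    (trans (sym (dist≡cycDist x y)) e₃)
    (points-triangle (toℕ<n x) (toℕ<n y) (toℕ<n z))

positions⇒nonzero : ∀ {n h i j} a b c → a < suc n → b < suc n → c < suc n →
  cycDist (suc n) b c ≡ h → cycDist (suc n) a c ≡ i → cycDist (suc n) a b ≡ j →
  ¬ IsZero (P (suc n) h i j)
positions⇒nonzero {n} a b c a<N b<N c<N e₁ e₂ e₃ P≡0 = 1+n≢0 (trans (sym coefficient≡1) (P≡0 x y z))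
  where
  x = fromℕ< a<N
  y = fromℕ< b<N
  z = fromℕ< c<N
  dist-fromℕ< : ∀ {u v} (u<N : u < suc n) (v<N : v < suc n) →
    dist (fromℕ< u<N) (fromℕ< v<N) ≡ cycDist (suc n) u v
  dist-fromℕ< u<N v<N = trans (dist≡cycDist (fromℕ< u<N) (fromℕ< v<N))
    (cong₂ (cycDist (suc n)) (toℕ-fromℕ< u<N) (toℕ-fromℕ< v<N))
  coefficient≡1 : P (suc n) _ _ _ x y z ≡ 1
  coefficient≡1 = distances⇒P-coefficient≡1 x y z
    (trans (dist-fromℕ< b<N c<N) e₁) (trans (dist-fromℕ< a<N c<N) e₂) (trans (dist-fromℕ< a<N b<N) e₃)

ThirdSide : ℕ → ℕ → ℕ → ℕ → Set
ThirdSide N h i j = j ≡ ∣ h - i ∣ ⊎ j ≡ minArc N (h + i)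

triangle⇒third-side : ∀ {N h i j} → j + j ≤ N → Triangle N h i j → ThirdSide N h i j
triangle⇒third-side {i = i} {j} _ (h≡i+j refl) = inj₁ (sym (trans (∣-∣-comm (i + j) i) (∣m-m+n∣≡n i j)))
triangle⇒third-side {h = h} {j = j} _ (i≡h+j refl) = inj₁ (sym (∣m-m+n∣≡n h j))
triangle⇒third-side 2j≤N (j≡h+i refl) = inj₂ (sym (minArc-short 2j≤N))
triangle⇒third-side {h = h} {i} {j} 2j≤N (h+i+j≡N refl) =
  inj₂ (sym (trans (minArc-+ (h + i) j) (m≥n⇒m⊓n≡n (+-cancelʳ-≤ j j (h + i) 2j≤N))))

-- Witnesses: z at 0, x at i, and y at h, or at N - h for j = minArc N (h + i).
third-side⇒nonzero : ∀ {n h i j} → h + h ≤ suc n → i + i ≤ suc n →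
  ThirdSide (suc n) h i j → ¬ IsZero (P (suc n) h i j)
third-side⇒nonzero {n} {h} {i} 2h≤N 2i≤N (inj₁ refl) = positions⇒nonzero i h 0
  (m+m≤1+n⇒m<1+n i 2i≤N) (m+m≤1+n⇒m<1+n h 2h≤N) z<s
  (trans (cycDist-zeroʳ _ h) (minArc-short 2h≤N)) (trans (cycDist-zeroʳ _ i) (minArc-short 2i≤N))
  (trans (cong (minArc (suc n)) (∣-∣-comm i h))
         (minArc-short (m+m≤o⇒n+n≤o⇒∣m-n∣+∣m-n∣≤o h i 2h≤N 2i≤N)))
third-side⇒nonzero {n} {zero} {i} _ 2i≤N (inj₂ refl) = positions⇒nonzero i 0 0
  (m+m≤1+n⇒m<1+n i 2i≤N) z<s z<s
  refl (trans (cycDist-zeroʳ _ i) (minArc-short 2i≤N)) (cycDist-zeroʳ _ i)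
third-side⇒nonzero {n} {h@(suc _)} {i} 2h≤N 2i≤N (inj₂ refl) = positions⇒nonzero i (N ∸ h) 0
  (m+m≤1+n⇒m<1+n i 2i≤N) (∸-monoʳ-< z<s h≤N) z<s
  (trans (cycDist-zeroʳ N (N ∸ h)) (trans (minArc-complement h≤N) (minArc-short 2h≤N)))
  (trans (cycDist-zeroʳ N i) (minArc-short 2i≤N))
  (begin
    minArc N ∣ i - (N ∸ h) ∣  ≡⟨ cong (minArc N) (m≤n⇒∣m-n∣≡n∸m (m+n≤o⇒m≤o∸n i i+h≤N)) ⟩
    minArc N (N ∸ h ∸ i)      ≡⟨ cong (minArc N) (∸-+-assoc N h i) ⟩
    minArc N (N ∸ (h + i))    ≡⟨ minArc-complement h+i≤N ⟩
    minArc N (h + i)          ∎)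
  where
  open ≡-Reasoning
  N = suc n
  h≤N = ≤-trans (m≤m+n h h) 2h≤N
  h+i≤N = m+m≤o⇒n+n≤o⇒m+n≤o h i 2h≤N 2i≤N
  i+h≤N : i + h ≤ N
  i+h≤N = subst (_≤ N) (+-comm h i) h+i≤N

nonzero⇔third-side : ∀ {n h i j} → h + h ≤ suc n → i + i ≤ suc n → j + j ≤ suc n →
  (¬ IsZero (P (suc n) h i j)) ⇔ ThirdSide (suc n) h i j
nonzero⇔third-side 2h≤N 2i≤N 2j≤N =
  mk⇔ (triangle⇒third-side 2j≤N ∘ nonzero⇒triangle) (third-side⇒nonzero 2h≤N 2i≤N)

-- The two vertices at distance k from a given vertex coincide.
Boundary : ℕ → ℕ → Set
Boundary N k = k ≡ 0 ⊎ k + k ≡ N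

boundary? : ∀ N k → Dec (Boundary N k)
boundary? N k = k ≟ 0 ⊎-dec k + k ≟ N

interior : ℕ → ℕ → ℕ
interior N k = if does (boundary? N k) then 0 else 1

interior-boundary : ∀ {N k} → Boundary N k → interior N k ≡ 0
interior-boundary {N} {k} b = cong (if_then 0 else 1) (dec-true (boundary? N k) b)

interior-¬boundary : ∀ {N k} → ¬ Boundary N k → interior N k ≡ 1
interior-¬boundary {N} {k} ¬b = cong (if_then 0 else 1) (dec-false (boundary? N k) ¬b)

boundary⇒coincide : ∀ {N h i} → i + i ≤ N → Boundary N h → ∣ h - i ∣ ≡ minArc N (h + i)
boundary⇒coincide 2i≤N (inj₁ refl) = sym (minArc-short 2i≤N)
boundary⇒coincide {h = h} {i} 2i≤2h (inj₂ refl) = begin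
  ∣ h - i ∣                      ≡⟨ m≤n⇒∣n-m∣≡n∸m (m+m≤1+n+n⇒m≤n i h (m≤n⇒m≤1+n 2i≤2h)) ⟩
  h ∸ i                          ≡⟨ m≥n⇒m⊓n≡n (≤-trans (m∸n≤m h i) (m≤m+n h i)) ⟨
  (h + i) ⊓ (h ∸ i)              ≡⟨ cong ((h + i) ⊓_) ([m+n]∸[m+o]≡n∸o h h i) ⟨
  minArc (h + h) (h + i)         ∎
  where open ≡-Reasoning

boundaries⇒coincide : ∀ {N h i} → h + h ≤ N → i + i ≤ N →
  Boundary N h ⊎ Boundary N i → ∣ h - i ∣ ≡ minArc N (h + i)
boundaries⇒coincide _ 2i≤N (inj₁ b) = boundary⇒coincide 2i≤N b
boundaries⇒coincide {N} {h} {i} 2h≤N _ (inj₂ b) =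
  trans (∣-∣-comm h i) (trans (boundary⇒coincide 2h≤N b) (cong (minArc N) (+-comm i h)))

long-coincide⇒antipodal : ∀ {N h i} → h ≤ i → h + i ≤ N → ∣ h - i ∣ ≡ N ∸ (h + i) → i + i ≡ N
long-coincide⇒antipodal {N} {h} {i} h≤i h+i≤N coincide = begin
  i + i                  ≡⟨ cong (_+ i) (m∸n+n≡m h≤i) ⟨
  i ∸ h + h + i          ≡⟨ +-assoc (i ∸ h) h i ⟩
  i ∸ h + (h + i)        ≡⟨ cong (_+ (h + i)) (trans (sym (m≤n⇒∣m-n∣≡n∸m h≤i)) coincide) ⟩
  N ∸ (h + i) + (h + i)  ≡⟨ m∸n+n≡m h+i≤N ⟩
  N                      ∎
  where open ≡-Reasoning

coincide⇒boundaries : ∀ {N} h i → h + h ≤ N → i + i ≤ N →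
  ∣ h - i ∣ ≡ minArc N (h + i) → Boundary N h ⊎ Boundary N i
coincide⇒boundaries zero    _       _ _ _ = inj₁ (inj₁ refl)
coincide⇒boundaries (suc _) zero    _ _ _ = inj₂ (inj₁ refl)
coincide⇒boundaries {N} h@(suc m) i@(suc n) 2h≤N 2i≤N coincide with (h + i) + (h + i) ≤? N
... | yes short = contradiction (trans coincide (minArc-short short)) (<⇒≢ (∣1+m-1+n∣<1+m+1+n m n))
... | no long with ≤-total h i
...   | inj₁ h≤i =
  inj₂ (inj₂ (long-coincide⇒antipodal h≤i (m+m≤o⇒n+n≤o⇒m+n≤o h i 2h≤N 2i≤N) long-coincide))
  where
  long-coincide = trans coincide (minArc-long (<⇒≤ (≰⇒> long)))
...   | inj₂ i≤h =
  inj₁ (inj₂ (long-coincide⇒antipodal i≤h (m+m≤o⇒n+n≤o⇒m+n≤o i h 2i≤N 2h≤N) long-coincide))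
  where
  long-coincide = trans (∣-∣-comm i h)
    (trans coincide (trans (minArc-long (<⇒≤ (≰⇒> long))) (cong (N ∸_) (+-comm h i))))

nonzero? : ∀ N h i j → Dec (¬ IsZero (P N h i j))
nonzero? N h i j = ¬? (isZero? (P N h i j))

length-filter-triples : ∀ {Q : Pred (ℕ × ℕ × ℕ) ℓ} (Q? : Decidable Q) D → let U = upTo (suc D) in
  length (filter Q? (triples D))
    ≡ sum (map (λ h → sum (map (λ i → length (filter (λ j → Q? (h , i , j)) U)) U)) U)
length-filter-triples Q? D =
  trans (length-filter-concatMap Q? (λ h → concatMap (λ i → map (λ j → h , i , j) U) U) U)
        (cong sum (map-cong row U))
  where
  U = upTo (suc D)
  row : ∀ h → length (filter Q? (concatMap (λ i → map (λ j → h , i , j) U) U))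
            ≡ sum (map (λ i → length (filter (λ j → Q? (h , i , j)) U)) U)
  row h = trans (length-filter-concatMap Q? (λ i → map (λ j → h , i , j) U) U)
                (cong sum (map-cong (λ i → length-filter-map Q? (λ j → h , i , j) U) U))

countNonzero≡double-sum : ∀ N D → let U = upTo (suc D) in
  countNonzero N D ≡ sum (map (λ h → sum (map (λ i → length (filter (nonzero? N h i) U)) U)) U)
countNonzero≡double-sum N D = length-filter-triples (λ { (h , i , j) → nonzero? N h i j }) D

third-sides-count : ∀ {n D h i} → D + D ≤ suc n → suc n ≤ suc (D + D) → h ≤ D → i ≤ D →
  length (filter (nonzero? (suc n) h i) (upTo (suc D))) ≡ 1 + interior (suc n) h * interior (suc n) i
third-sides-count {n} {D} {h} {i} 2D≤N N≤1+2D h≤D i≤D = begin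
  length (filter (nonzero? N h i) U) ≡⟨ cong length (filter-≐-local (nonzero? N h i) third-side? nonzero⇔) ⟩
  length (filter third-side? U)      ≡⟨ count (boundary? N h ⊎-dec boundary? N i) ⟩
  1 + interior N h * interior N i    ∎
  where
  open ≡-Reasoning
  N = suc n
  U = upTo (suc D)
  third-side? : Decidable (ThirdSide N h i)
  third-side? j = j ≟ ∣ h - i ∣ ⊎-dec j ≟ minArc N (h + i)
  half : ∀ {k} → k ≤ D → k + k ≤ N
  half k≤D = ≤-trans (+-mono-≤ k≤D k≤D) 2D≤N
  nonzero⇔ = applyUpTo⁺₁ id (suc D) λ j<1+D →
    nonzero⇔third-side (half h≤D) (half i≤D) (half (m<1+n⇒m≤n j<1+D))
  ∣h-i∣<1+D : ∣ h - i ∣ < suc D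
  ∣h-i∣<1+D = s≤s (≤-trans (∣m-n∣≤m⊔n h i) (⊔-lub h≤D i≤D))
  minArc<1+D : minArc N (h + i) < suc D
  minArc<1+D = s≤s (m+m≤1+n+n⇒m≤n _ D
    (≤-trans (minArc-half (m+m≤o⇒n+n≤o⇒m+n≤o h i (half h≤D) (half i≤D))) N≤1+2D))
  count : Dec (Boundary N h ⊎ Boundary N i) → length (filter third-side? U) ≡ 1 + interior N h * interior N i
  count (yes (inj₁ bh)) rewrite interior-boundary bh =
    length-filter-≟-pair-≡ (suc D) ∣h-i∣<1+D (boundaries⇒coincide (half h≤D) (half i≤D) (inj₁ bh))
  count (yes (inj₂ bi)) rewrite interior-boundary bi | *-zeroʳ (interior N h) =
    length-filter-≟-pair-≡ (suc D) ∣h-i∣<1+D (boundaries⇒coincide (half h≤D) (half i≤D) (inj₂ bi))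
  count (no ¬b) rewrite interior-¬boundary (¬b ∘ inj₁) | interior-¬boundary (¬b ∘ inj₂) =
    length-filter-≟-pair-≢ (suc D) ∣h-i∣<1+D minArc<1+D
      (¬b ∘ coincide⇒boundaries h i (half h≤D) (half i≤D))

interior-count : ℕ → ℕ → ℕ
interior-count N D = sum (map (interior N) (upTo (suc D)))

countNonzero-formula : ∀ {n D} → D + D ≤ suc n → suc n ≤ suc (D + D) →
  countNonzero (suc n) D ≡ suc D * suc D + interior-count (suc n) D * interior-count (suc n) D
countNonzero-formula {n} {D} 2D≤N N≤1+2D = begin
  countNonzero N D
    ≡⟨ countNonzero≡double-sum N D ⟩
  sum (map (λ h → sum (map (λ i → length (filter (nonzero? N h i) U)) U)) U)
    ≡⟨ cong sum (map-cong-upTo (suc D) row) ⟩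
  sum (map (λ h → sum (map (λ i → 1 + interior N h * interior N i) U)) U)
    ≡⟨ sum-map-1+product (interior N) U ⟩
  length U * length U + I * I
    ≡⟨ cong (λ l → l * l + I * I) (length-upTo (suc D)) ⟩
  suc D * suc D + I * I
    ∎
  where
  open ≡-Reasoning
  N = suc n
  U = upTo (suc D)
  I = interior-count N D
  row : ∀ {h} → h < suc D → sum (map (λ i → length (filter (nonzero? N h i) U)) U)
                           ≡ sum (map (λ i → 1 + interior N h * interior N i) U)
  row h<1+D = cong sum (map-cong-upTo (suc D) λ i<1+D →
    third-sides-count 2D≤N N≤1+2D (m<1+n⇒m≤n h<1+D) (m<1+n⇒m≤n i<1+D))

interior-count-even : ∀ m → interior-count (suc m + suc m) (suc m) ≡ m
interior-count-even m = begin
  sum (map g (upTo (suc (suc m))))        ≡⟨ sum-map-upTo-∷ʳ g (suc m) ⟩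
  sum (map g (upTo (suc m))) + g (suc m)   ≡⟨ cong (sum (map g (upTo (suc m))) +_) D-boundary ⟩
  sum (map g (upTo (suc m))) + 0           ≡⟨ +-identityʳ _ ⟩
  sum (map g (upTo (suc m)))               ≡⟨ sum-map-upTo-suc g m ⟩
  g 0 + sum (map (g ∘ suc) (upTo m))       ≡⟨ sum-map-upTo-const (g ∘ suc) m inner ⟩
  m * 1                                    ≡⟨ *-identityʳ m ⟩
  m                                        ∎
  where
  open ≡-Reasoning
  g = interior (suc m + suc m)
  D-boundary : g (suc m) ≡ 0
  D-boundary = interior-boundary {suc m + suc m} {suc m} (inj₂ refl)
  inner : ∀ {k} → k < m → g (suc k) ≡ 1
  inner {k} k<m = interior-¬boundary {suc m + suc m} {suc k} λ where
    (inj₁ ())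
    (inj₂ e) → <⇒≢ (+-mono-< (s≤s k<m) (s≤s k<m)) e

interior-count-odd : ∀ D → interior-count (suc (D + D)) D ≡ D
interior-count-odd D = begin
  sum (map g (upTo (suc D)))               ≡⟨ sum-map-upTo-suc g D ⟩
  g 0 + sum (map (g ∘ suc) (upTo D))       ≡⟨ sum-map-upTo-const (g ∘ suc) D inner ⟩
  D * 1                                    ≡⟨ *-identityʳ D ⟩
  D                                        ∎
  where
  open ≡-Reasoning
  g = interior (suc (D + D))
  inner : ∀ {k} → k < D → g (suc k) ≡ 1
  inner {k} k<D = interior-¬boundary {suc (D + D)} {suc k} λ where
    (inj₁ ())
    (inj₂ e) → <⇒≢ (≤-<-trans (+-mono-≤ k<D k<D) (n<1+n (D + D))) e

countNonzero-even : ∀ m → countNonzero (suc m + suc m) (suc m) ≡ suc (suc m) * suc (suc m) + m * m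
countNonzero-even m = trans (countNonzero-formula {m + D} {D} ≤-refl (n≤1+n (D + D)))
  (cong (λ c → suc D * suc D + c * c) (interior-count-even m))
  where D = suc m

countNonzero-odd : ∀ D → countNonzero (suc (D + D)) D ≡ suc D * suc D + D * D
countNonzero-odd D = trans (countNonzero-formula {D + D} {D} (n≤1+n (D + D)) ≤-refl)
  (cong (λ c → suc D * suc D + c * c) (interior-count-odd D))

lemma6p2 : (D N : ℕ) → 2 ≤ D →
    (N ≡ 2 * D → countNonzero N D ≡ 2 * D * D + 2) ×
    (N ≡ 2 * D + 1 → countNonzero N D ≡ 2 * D * D + 2 * D + 1)
lemma6p2 zero      _ ()
lemma6p2 D@(suc m) N _ = even , odd
  where
  open ≡-Reasoning
  even : N ≡ 2 * D → countNonzero N D ≡ 2 * D * D + 2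
  even refl = begin
    countNonzero (2 * D) D                  ≡⟨ cong (λ M → countNonzero M D) (cong (D +_) (+-identityʳ D)) ⟩
    countNonzero (D + D) D                  ≡⟨ countNonzero-even m ⟩
    suc D * suc D + m * m                   ≡⟨ arithmetic m ⟩
    2 * D * D + 2                           ∎
    where
    arithmetic : ∀ m → suc (suc m) * suc (suc m) + m * m ≡ 2 * suc m * suc m + 2
    arithmetic = solve-∀
  odd : N ≡ 2 * D + 1 → countNonzero N D ≡ 2 * D * D + 2 * D + 1
  odd refl = begin
    countNonzero (2 * D + 1) D              ≡⟨ cong (λ M → countNonzero M D) (2D+1≡1+D+D D) ⟩
    countNonzero (suc (D + D)) D            ≡⟨ countNonzero-odd D ⟩
    suc D * suc D + D * D                   ≡⟨ arithmetic D ⟩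
    2 * D * D + 2 * D + 1                   ∎
    where
    2D+1≡1+D+D : ∀ D → 2 * D + 1 ≡ suc (D + D)
    2D+1≡1+D+D = solve-∀
    arithmetic : ∀ D → suc D * suc D + D * D ≡ 2 * D * D + 2 * D + 1
    arithmetic = solve-∀
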